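{- Let $G=(V,E)$ be a finite connected undirected graph (not necessarily complete or metric) with edge costs $c(e) \ge 0$ for $e \in E$, and let $T \subseteq V$ be nonempty. Let $\mu : 2^V \rightarrow \mathbb{Q}_{\geq 0}$ be a probability distribution over subsets of $V \setminus T$ (i.e. supported on subsets of $V\setminus T$), and let $\gamma \geq 0$ be such that for every $v \in V\setminus T$, $\mathbf{Pr}_{S \sim \mu}[v \notin S] \leq \gamma$. Then $\mathbf{E}_{S\sim\mu}[c_{T \cup S}] \leq \gamma \cdot c_T$.
   Context: For a nonempty $R \subseteq V$, an $R$-rooted spanning forest is a forest $F \subseteq E$ such that each connected component of the spanning subgraph $(V,F)$ contains exactly one node of $R$. The cost of $F$ is $\sum_{e\in F} c(e)$, and $c_R$ denotes the minimum cost of an $R$-rooted spanning forest. -}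

module Defs where

open import Algebra.Bundles using (CommutativeRing)
open import Data.Bool.Base using (if_then_else_)
open import Data.Empty using (⊥-elim)
open import Data.Fin.Base using (Fin; _<_)
open import Data.Fin.Properties using (_≟_; any?; all?)
open import Data.Fin.Subset using
  (Subset; inside; outside; _∈_; _∉_; _⊆_; _∪_; ⊤; Nonempty)
open import Data.Fin.Subset.Properties using (_∈?_; ∈⊤; p⊆p∪q)
open import Data.List.Base using (List; []; _∷_; allFin)
open import Data.List.Membership.Propositional using () renaming (_∈_ to _∈ˡ_)
open import Data.List.Membership.Propositional.Properties using (∈-allFin)
open import Data.List.Relation.Unary.All using (All; []; _∷_)
import Data.List.Relation.Unary.All as All
open import Data.List.Relation.Unary.AllPairs using ([]; _∷_)
open import Data.List.Relation.Unary.Any using (here; there)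
open import Data.List.Relation.Unary.Unique.Propositional using (Unique)
open import Data.Maybe.Base using (Maybe; just; nothing)
open import Data.Nat.Base as ℕ using (ℕ; z≤n; s≤s)
import Data.Nat.Properties as ℕ
open import Data.Product using (∃; ∃₂; ∃!; _×_; _,_; proj₁; proj₂)
open import Data.Sum using (_⊎_; inj₁; inj₂; swap)
open import Data.Vec.Base using ([]; _∷_; lookup; tabulate)
open import Data.Vec.Properties using
  (lookup∘tabulate; []=⇒lookup; lookup⇒[]=)
open import Function.Base using (_∘_; id)
open import Level using (_⊔_)
open import Relation.Binary.PropositionalEquality as ≡ using (_≡_; _≢_; cong)
open import Relation.Binary.Structures using (IsTotalOrder)
open import Relation.Nullary using (¬_; Dec; yes; no; does)
open import Relation.Nullary.Decidable using (_×-dec_; _⊎-dec_; map′)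
open import Relation.Unary using (Pred; Decidable)

------------------------------------------------------------------------
-- Ordered fields

-- Stands in for the real numbers, which the standard library lacks.
record OrderedField a ℓ₁ ℓ₂ : Set (Level.suc (a ⊔ ℓ₁ ⊔ ℓ₂)) where
  infix 4 _≤_
  field
    commutativeRing : CommutativeRing a ℓ₁
  open CommutativeRing commutativeRing public
  field
    _≤_          : Carrier → Carrier → Set ℓ₂
    isTotalOrder : IsTotalOrder _≈_ _≤_
    +-monoˡ-≤    : ∀ z {x y} → x ≤ y → z + x ≤ z + y
    *-nonNeg     : ∀ {x y} → 0# ≤ x → 0# ≤ y → 0# ≤ x * y
    0#≉1#        : ¬ (0# ≈ 1#)
    inverse      : ∀ x → ¬ (x ≈ 0#) → ∃ λ y → x * y ≈ 1#
  open IsTotalOrder isTotalOrder public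
    using (total; antisym; ≤-respˡ-≈; ≤-respʳ-≈)
    renaming (refl to ≤-refl; trans to ≤-trans; reflexive to ≤-reflexive)
  open import Algebra.Properties.CommutativeMonoid.Sum +-commutativeMonoid
    public using (sum; sum-syntax)
  open import Algebra.Definitions.RawMonoid +-rawMonoid
    public using () renaming (_×_ to _·_)

  -- x = p / (1 + q) for some natural numbers p and q.
  IsNonNegRational : Carrier → Set ℓ₁
  IsNonNegRational x = ∃₂ λ p q → (ℕ.suc q · 1#) * x ≈ p · 1#

------------------------------------------------------------------------
-- Finite simple graphs

-- An edge {u , v} is stored once, with its smaller endpoint as src.
record Graph : Set where
  field
    n m     : ℕ
    src tgt : Fin m → Fin n
    src<tgt : ∀ e → src e < tgt e
    simple  : ∀ {e f} → src e ≡ src f → tgt e ≡ tgt f → e ≡ f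

  Vertex = Fin n
  Edge   = Fin m

  Joins : Edge → Vertex → Vertex → Set
  Joins e u v = (src e ≡ u × tgt e ≡ v) ⊎ (src e ≡ v × tgt e ≡ u)

  infixr 5 _∷⟨_⟩_

  data Walk (F : Subset m) : Vertex → Vertex → Set where
    []     : ∀ {u} → Walk F u u
    _∷⟨_⟩_ : ∀ {e u v w} → e ∈ F → Joins e u v → Walk F v w → Walk F u w

  edges : ∀ {F u v} → Walk F u v → List Edge
  edges []                   = []
  edges (_∷⟨_⟩_ {e = e} _ _ w) = e ∷ edges w

  -- The final vertex is left out, so that on a closed walk the base point
  -- is listed once.
  vertices : ∀ {F u v} → Walk F u v → List Vertex
  vertices []                   = []
  vertices (_∷⟨_⟩_ {u = u} _ _ w) = u ∷ vertices w

  -- Distinctness of the edges rules out traversing one edge back and forth.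
  IsCycle : ∀ {F u} → Walk F u u → Set
  IsCycle w = edges w ≢ [] × Unique (edges w) × Unique (vertices w)

  IsForest : Subset m → Set
  IsForest F = ∀ {u} (w : Walk F u u) → ¬ IsCycle w

  IsConnected : Set
  IsConnected = ∀ u v → Walk ⊤ u v

  -- Every component is the component of some vertex v.
  IsRootedSpanningForest : Subset n → Subset m → Set
  IsRootedSpanningForest R F =
    IsForest F × (∀ v → ∃! _≡_ λ r → r ∈ R × Walk F v r)

------------------------------------------------------------------------
-- Walks and reachability

module Reachability (G : Graph) where
  open Graph G

  symJ : ∀ {e u v} → Joins e u v → Joins e v u
  symJ = swap

  infixr 5 _++ʷ_
  _++ʷ_ : ∀ {F u v w} → Walk F u v → Walk F v w → Walk F u w
  []              ++ʷ q = q
  (e∈F ∷⟨ j ⟩ p) ++ʷ q = e∈F ∷⟨ j ⟩ (p ++ʷ q)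

  reverseʷ : ∀ {F u v} → Walk F u v → Walk F v u
  reverseʷ []              = []
  reverseʷ (e∈F ∷⟨ j ⟩ p) = reverseʷ p ++ʷ (e∈F ∷⟨ symJ j ⟩ [])

  Walk-mono : ∀ {F F′ u v} → F ⊆ F′ → Walk F u v → Walk F′ u v
  Walk-mono F⊆F′ []              = []
  Walk-mono F⊆F′ (e∈F ∷⟨ j ⟩ p) = F⊆F′ e∈F ∷⟨ j ⟩ Walk-mono F⊆F′ p

  -- Union-find: lab v is a representative of the component of v in the
  -- subgraph whose edges are those of F in es.
  record Labelling (F : Subset m) (es : List Edge) : Set where
    field
      lab   : Vertex → Vertex
      reach : ∀ v → Walk F v (lab v)
      agree : ∀ {e} → e ∈ˡ es → e ∈ F → lab (src e) ≡ lab (tgt e)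

  labelling : ∀ F es → Labelling F es
  labelling F []       = record { lab = id ; reach = λ _ → [] ; agree = λ () }
  labelling F (e ∷ es) with e ∈? F
  ... | no  e∉F = record
    { lab   = lab
    ; reach = reach
    ; agree = λ { (here ≡.refl) e∈F → ⊥-elim (e∉F e∈F) ; (there i) → agree i }
    } where open Labelling (labelling F es)
  ... | yes e∈F = record { lab = φ ∘ lab ; reach = reach′ ; agree = agree′ }
    where
    open Labelling (labelling F es)
    φ : Vertex → Vertex
    φ x with x ≟ lab (src e)
    ... | yes _ = lab (tgt e)
    ... | no  _ = x
    φ-src : φ (lab (src e)) ≡ lab (tgt e)
    φ-src with lab (src e) ≟ lab (src e)
    ... | yes _ = ≡.refl
    ... | no  ¬p = ⊥-elim (¬p ≡.refl)
    φ-tgt : φ (lab (tgt e)) ≡ lab (tgt e)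
    φ-tgt with lab (tgt e) ≟ lab (src e)
    ... | yes _ = ≡.refl
    ... | no  _ = ≡.refl
    φ-walk : ∀ x → Walk F x (φ x)
    φ-walk x with x ≟ lab (src e)
    ... | yes ≡.refl =
      reverseʷ (reach (src e))
        ++ʷ (e∈F ∷⟨ inj₁ (≡.refl , ≡.refl) ⟩ reach (tgt e))
    ... | no _ = []
    reach′ : ∀ v → Walk F v (φ (lab v))
    reach′ v = reach v ++ʷ φ-walk (lab v)
    agree′ : ∀ {f} → f ∈ˡ (e ∷ es) → f ∈ F → φ (lab (src f)) ≡ φ (lab (tgt f))
    agree′ (here ≡.refl) _   = ≡.trans φ-src (≡.sym φ-tgt)
    agree′ (there i)     f∈F = cong φ (agree i f∈F)

  walk? : ∀ F u v → Dec (Walk F u v)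
  walk? F u v = map′ to from (lab u ≟ lab v)
    where
    open Labelling (labelling F (allFin m))
    to : lab u ≡ lab v → Walk F u v
    to eq = ≡.subst (Walk F u) eq (reach u) ++ʷ reverseʷ (reach v)
    from : ∀ {u v} → Walk F u v → lab u ≡ lab v
    from []             = ≡.refl
    from (_∷⟨_⟩_ {e = e} e∈F (inj₁ (≡.refl , ≡.refl)) p) =
      ≡.trans (agree (∈-allFin e) e∈F) (from p)
    from (_∷⟨_⟩_ {e = e} e∈F (inj₂ (≡.refl , ≡.refl)) p) =
      ≡.trans (≡.sym (agree (∈-allFin e) e∈F)) (from p)

  -- Every component of (V , F) meets R.
  Spans : Subset n → Subset m → Set
  Spans R F = ∀ v → ∃ λ r → r ∈ R × Walk F v r

  spans? : ∀ R → Decidable (Spans R)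
  spans? R F = all? λ v → any? λ r → (r ∈? R) ×-dec walk? F v r

------------------------------------------------------------------------
-- Rooted spanning forests from parent pointers

module ParentPointers (G : Graph) where
  open Graph G
  open Reachability G

  record Step (F : Subset m) (depth : Vertex → ℕ) (v : Vertex) : Set where
    constructor step
    field
      edge    : Edge
      parent  : Vertex
      edge∈F  : edge ∈ F
      joins   : Joins edge v parent
      descend : depth parent ℕ.< depth v

  record Parents (R : Subset n) (F : Subset m) : Set where
    field
      depth : Vertex → ℕ
      up    : ∀ v → v ∈ R ⊎ (v ∉ R × Step F depth v)

  module Tree {R F} (P : Parents R F) where
    open Parents P

    parentEdge : Vertex → Maybe Edge
    parentEdge v with up v
    ... | inj₁ _       = nothing
    ... | inj₂ (_ , s) = just (Step.edge s)

    ParentEdge : Vertex → Edge → Set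
    ParentEdge v e = parentEdge v ≡ just e

    parentEdge? : ∀ v e → Dec (ParentEdge v e)
    parentEdge? v e with parentEdge v
    ... | nothing = no λ ()
    ... | just f  = map′ (cong just) (λ { ≡.refl → ≡.refl }) (f ≟ e)

    unique : ∀ {v e f} → ParentEdge v e → ParentEdge v f → e ≡ f
    unique p q with ≡.trans (≡.sym p) q
    ... | ≡.refl = ≡.refl

    forest : Subset m
    forest = tabulate λ e → does (any? λ v → parentEdge? v e)

    ∈forest⁺ : ∀ {v e} → ParentEdge v e → e ∈ forest
    ∈forest⁺ {v} {e} p = lookup⇒[]= e forest
      (≡.trans (lookup∘tabulate _ e) (lemma (any? λ v → parentEdge? v e)))
      where
      lemma : (d : Dec (∃ λ v → ParentEdge v e)) → does d ≡ inside
      lemma (yes _) = ≡.refl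
      lemma (no ¬p) = ⊥-elim (¬p (v , p))

    ∈forest⁻ : ∀ {e} → e ∈ forest → ∃ λ v → ParentEdge v e
    ∈forest⁻ {e} e∈ = lemma (any? λ v → parentEdge? v e)
      (≡.trans (≡.sym (lookup∘tabulate _ e)) ([]=⇒lookup e∈))
      where
      lemma : (d : Dec (∃ λ v → ParentEdge v e)) → does d ≡ inside →
              ∃ λ v → ParentEdge v e
      lemma (yes p) _ = p

    -- Membership of e in the forest, resolved to a vertex and its step up.
    record Arc (e : Edge) : Set where
      constructor arc
      field
        child   : Vertex
        child∉R : child ∉ R
        theStep : Step F depth child
        up≡     : up child ≡ inj₂ (child∉R , theStep)
        edge≡   : Step.edge theStep ≡ e

    arcOf : ∀ {v e} → ParentEdge v e → Arc e
    arcOf {v} p with up v in eq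
    arcOf {v} ≡.refl | inj₂ (v∉R , s) = arc v v∉R s eq ≡.refl

    parentEdge-of : ∀ {v v∉R s} → up v ≡ inj₂ (v∉R , s) →
                    ParentEdge v (Step.edge s)
    parentEdge-of eq rewrite eq = ≡.refl

    forest⊆F : forest ⊆ F
    forest⊆F e∈ with arcOf (proj₂ (∈forest⁻ e∈))
    ... | arc _ _ s _ ≡.refl = Step.edge∈F s

    -- Each step of a walk in the forest goes to the parent or to a child.
    data Dir (e : Edge) (a b : Vertex) : Set where
      toParent : (a∉R : a ∉ R) (s : Step F depth a) →
                 up a ≡ inj₂ (a∉R , s) → Step.edge s ≡ e →
                 Step.parent s ≡ b → Dir e a b
      toChild  : (b∉R : b ∉ R) (s : Step F depth b) →
                 up b ≡ inj₂ (b∉R , s) → Step.edge s ≡ e →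
                 Step.parent s ≡ a → Dir e a b

    joins-det : ∀ {e a b c d} → Joins e a b → Joins e c d →
                (a ≡ c × b ≡ d) ⊎ (a ≡ d × b ≡ c)
    joins-det (inj₁ (≡.refl , ≡.refl)) (inj₁ (≡.refl , ≡.refl)) =
      inj₁ (≡.refl , ≡.refl)
    joins-det (inj₁ (≡.refl , ≡.refl)) (inj₂ (≡.refl , ≡.refl)) =
      inj₂ (≡.refl , ≡.refl)
    joins-det (inj₂ (≡.refl , ≡.refl)) (inj₁ (≡.refl , ≡.refl)) =
      inj₂ (≡.refl , ≡.refl)
    joins-det (inj₂ (≡.refl , ≡.refl)) (inj₂ (≡.refl , ≡.refl)) =
      inj₁ (≡.refl , ≡.refl)

    direction : ∀ {e a b} → e ∈ forest → Joins e a b → Dir e a b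
    direction e∈ j with arcOf (proj₂ (∈forest⁻ e∈))
    ... | arc v v∉R s eq ≡.refl with joins-det (Step.joins s) j
    ...   | inj₁ (≡.refl , p≡) = toParent v∉R s eq ≡.refl p≡
    ...   | inj₂ (≡.refl , p≡) = toChild  v∉R s eq ≡.refl p≡

    onlyEdge : ∀ {v e es} → ParentEdge v e → All (e ≢_) es →
               ∀ {f} → ParentEdge v f → All (f ≢_) es
    onlyEdge {es = es} p e≢ q = ≡.subst (λ f → All (f ≢_) es) (unique p q) e≢

    -- Once a trail has gone down it cannot turn back up.
    descending : ∀ {u v} (w : Walk forest u v) → Unique (edges w) →
                 (∀ {e} → ParentEdge u e → All (e ≢_) (edges w)) →
                 depth u ℕ.≤ depth v ×
                 (u ≡ v ⊎ ∃ λ e → ParentEdge v e × e ∈ˡ edges w)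
    descending [] _ _ = ℕ.≤-refl , inj₁ ≡.refl
    descending (e∈ ∷⟨ j ⟩ w) (e≢ ∷ uw) fresh with direction e∈ j
    ... | toParent _ _ eq ≡.refl _ =
      ⊥-elim (All.head (fresh (parentEdge-of eq)) ≡.refl)
    ... | toChild _ s eq ≡.refl ≡.refl
      with descending w uw (onlyEdge (parentEdge-of eq) e≢)
    ...   | d , r = ℕ.≤-trans (ℕ.<⇒≤ (Step.descend s)) d , inj₂ (last r)
      where
      last : ∀ {x} →
             (_ ≡ x ⊎ ∃ λ e → ParentEdge x e × e ∈ˡ edges w) →
             ∃ λ e → ParentEdge x e × e ∈ˡ (_ ∷ edges w)
      last (inj₁ ≡.refl)       = _ , parentEdge-of eq , here ≡.refl
      last (inj₂ (e , pe , i)) = e , pe , there i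

    trail : ∀ {u v} (w : Walk forest u v) → Unique (edges w) →
            depth v ℕ.≤ depth u ⊎ ∃ λ e → ParentEdge v e × e ∈ˡ edges w
    trail [] _ = inj₁ ℕ.≤-refl
    trail (e∈ ∷⟨ j ⟩ w) (e≢ ∷ uw) with direction e∈ j
    ... | toParent _ s _ _ ≡.refl with trail w uw
    ...   | inj₁ d            = inj₁ (ℕ.≤-trans d (ℕ.<⇒≤ (Step.descend s)))
    ...   | inj₂ (f , pe , i) = inj₂ (f , pe , there i)
    trail (e∈ ∷⟨ j ⟩ w) (e≢ ∷ uw) | toChild _ s eq ≡.refl _
      with proj₂ (descending w uw (onlyEdge (parentEdge-of eq) e≢))
    ... | inj₁ ≡.refl       = inj₂ (_ , parentEdge-of eq , here ≡.refl)
    ... | inj₂ (f , pe , i) = inj₂ (f , pe , there i)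

    acyclic : IsForest forest
    acyclic [] (≢[] , _) = ≢[] ≡.refl
    acyclic (e∈ ∷⟨ j ⟩ w) (_ , e≢ ∷ uw , _) with direction e∈ j
    ... | toChild _ s eq ≡.refl ≡.refl =
      ℕ.<⇒≱ (Step.descend s)
        (proj₁ (descending w uw (onlyEdge (parentEdge-of eq) e≢)))
    ... | toParent _ s eq ≡.refl ≡.refl with trail w uw
    ...   | inj₁ d            = ℕ.<⇒≱ (Step.descend s) d
    ...   | inj₂ (f , pe , i) =
      All.lookup e≢ i (unique (parentEdge-of eq) pe)

    data Root : Vertex → Vertex → Set where
      stop : ∀ {v} (v∈R : v ∈ R) → up v ≡ inj₁ v∈R → Root v v
      next : ∀ {v r} (v∉R : v ∉ R) (s : Step F depth v) →
             up v ≡ inj₂ (v∉R , s) → Root (Step.parent s) r → Root v r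

    root-self : ∀ {r} → r ∈ R → Root r r
    root-self {r} r∈R with up r in eq
    ... | inj₁ p         = stop p eq
    ... | inj₂ (r∉R , _) = ⊥-elim (r∉R r∈R)

    root-unique : ∀ {v r r′} → Root v r → Root v r′ → r ≡ r′
    root-unique (stop _ _) (stop _ _)          = ≡.refl
    root-unique (stop p _) (next v∉R _ _ _)    = ⊥-elim (v∉R p)
    root-unique (next v∉R _ _ _) (stop p _)    = ⊥-elim (v∉R p)
    root-unique (next _ s eq a) (next _ t eq′ b) with ≡.trans (≡.sym eq) eq′
    ... | ≡.refl = root-unique a b

    root-walk : ∀ {a b r} → Walk forest a b → Root a r → Root b r
    root-walk []              ρ = ρ
    root-walk (e∈ ∷⟨ j ⟩ w) ρ with direction e∈ j
    ... | toChild b∉R s eq _ ≡.refl = root-walk w (next b∉R s eq ρ)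
    ... | toParent a∉R s eq _ ≡.refl with ρ
    ...   | stop p _ = ⊥-elim (a∉R p)
    ...   | next _ t eq′ ρ′ with ≡.trans (≡.sym eq) eq′
    ...     | ≡.refl = root-walk w ρ′

    climb : ∀ k v → depth v ℕ.< k → ∃ λ r → r ∈ R × Walk forest v r
    climb (ℕ.suc k) v (s≤s d≤k) with up v in eq
    ... | inj₁ v∈R       = v , v∈R , []
    ... | inj₂ (v∉R , s)
      with climb k (Step.parent s) (ℕ.<-≤-trans (Step.descend s) d≤k)
    ...   | r , r∈R , w =
      r , r∈R , ∈forest⁺ (parentEdge-of eq) ∷⟨ Step.joins s ⟩ w

    forest-rooted : IsRootedSpanningForest R forest
    forest-rooted = acyclic , λ v →
      let r , r∈R , w = climb _ v ℕ.≤-refl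
      in r , (r∈R , w) , λ { (r′∈R , w′) →
           ≡.sym (root-unique
             (root-self r′∈R)
             (root-walk w′ (root-walk (reverseʷ w) (root-self r∈R)))) }

  -- Parent pointers along shortest walks to R.
  module _ (R : Subset n) (F : Subset m) (spans : Spans R F) where

    Near : ℕ → Vertex → Set
    Near ℕ.zero    v = v ∈ R
    Near (ℕ.suc k) v = ∃ λ e → ∃ λ u → e ∈ F × Joins e v u × Near k u

    near? : ∀ k v → Dec (Near k v)
    near? ℕ.zero    v = v ∈? R
    near? (ℕ.suc k) v = any? λ e → any? λ u →
      (e ∈? F) ×-dec (joins? e v u ×-dec near? k u)
      where
      joins? : ∀ e a b → Dec (Joins e a b)
      joins? e a b = (src e ≟ a ×-dec tgt e ≟ b) ⊎-dec
                     (src e ≟ b ×-dec tgt e ≟ a)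

    walk⇒near : ∀ {v r} → r ∈ R → Walk F v r → ∃ λ k → Near k v
    walk⇒near r∈R []              = 0 , r∈R
    walk⇒near r∈R (e∈F ∷⟨ j ⟩ w) =
      let k , nr = walk⇒near r∈R w in ℕ.suc k , _ , _ , e∈F , j , nr

    Least : Vertex → ℕ → Set
    Least v k = Near k v × (∀ i → Near i v → k ℕ.≤ i)

    least : ∀ v → ∃ (Least v)
    least v = search k 0 (λ _ _ → z≤n)
                (≡.subst (λ i → Near i v) (≡.sym (ℕ.+-identityʳ k)) nr)
      where
      near = let _ , r∈R , w = spans v in walk⇒near r∈R w
      k  = proj₁ near
      nr = proj₂ near
      search : ∀ fuel i → (∀ j → Near j v → i ℕ.≤ j) → Near (fuel ℕ.+ i) v →
               ∃ (Least v)
      search ℕ.zero       i below nr = i , nr , below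
      search (ℕ.suc fuel) i below nr with near? i v
      ... | yes p = i , p , below
      ... | no ¬p = search fuel (ℕ.suc i)
        (λ j p → ℕ.≤∧≢⇒< (below j p) (λ { ≡.refl → ¬p p }))
        (≡.subst (λ i → Near i v) (≡.sym (ℕ.+-suc fuel i)) nr)

    distance : Vertex → ℕ
    distance v = proj₁ (least v)

    shortestParents : Parents R F
    shortestParents = record { depth = distance ; up = up }
      where
      parentStep : ∀ v → v ∉ R → ∀ k → distance v ≡ k → Near k v →
                   Step F distance v
      parentStep v v∉R ℕ.zero    _  v∈R                    = ⊥-elim (v∉R v∈R)
      parentStep v v∉R (ℕ.suc k) eq (e , u , e∈F , j , nr) =
        step e u e∈F j
          (≡.subst (distance u ℕ.<_) (≡.sym eq)
                   (s≤s (proj₂ (proj₂ (least u)) k nr)))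
      up : ∀ v → v ∈ R ⊎ (v ∉ R × Step F distance v)
      up v with v ∈? R
      ... | yes p = inj₁ p
      ... | no ¬p = inj₂ (¬p , parentStep v ¬p _ ≡.refl (proj₁ (proj₂ (least v))))

  prune : ∀ {R F} → Spans R F →
          ∃ λ F′ → F′ ⊆ F × IsRootedSpanningForest R F′
  prune {R} {F} spans = forest , forest⊆F , forest-rooted
    where open Tree (shortestParents R F spans)

------------------------------------------------------------------------
-- Costs of rooted spanning forests

module _ {a ℓ₁ ℓ₂} (K : OrderedField a ℓ₁ ℓ₂) where
  open OrderedField K

  module ForestCosts
    (G : Graph) (connected : Graph.IsConnected G)
    (c : Graph.Edge G → Carrier) (c≥0 : ∀ e → 0# ≤ c e)
    where
    open Graph G
    open Reachability G
    open ParentPointers G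

    cost : Subset m → Carrier
    cost F = ∑[ e < m ] (if lookup F e then c e else 0#)

    IsMinRootedSpanningForest : Subset n → Subset m → Set ℓ₂
    IsMinRootedSpanningForest R F =
      IsRootedSpanningForest R F ×
      (∀ F′ → IsRootedSpanningForest R F′ → cost F ≤ cost F′)

    +-mono-≤ : ∀ {w x y z} → w ≤ x → y ≤ z → w + y ≤ x + z
    +-mono-≤ {w} {x} {y} {z} w≤x y≤z =
      ≤-trans (+-monoˡ-≤ w y≤z)
        (≤-respˡ-≈ (+-comm z w) (≤-respʳ-≈ (+-comm z x) (+-monoˡ-≤ z w≤x)))

    sum-mono-≤ : ∀ {k} (f g : Fin k → Carrier) → (∀ i → f i ≤ g i) →
                 sum f ≤ sum g
    sum-mono-≤ {ℕ.zero}  f g f≤g = ≤-refl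
    sum-mono-≤ {ℕ.suc k} f g f≤g =
      +-mono-≤ (f≤g Fin.zero)
               (sum-mono-≤ (f ∘ Fin.suc) (g ∘ Fin.suc) (f≤g ∘ Fin.suc))

    cost-mono : ∀ {F F′} → F ⊆ F′ → cost F ≤ cost F′
    cost-mono {F} {F′} F⊆F′ = sum-mono-≤ _ _ term
      where
      term : ∀ e → (if lookup F e then c e else 0#) ≤
                   (if lookup F′ e then c e else 0#)
      term e with lookup F e in eq | lookup F′ e in eq′
      ... | outside | outside = ≤-refl
      ... | outside | inside  = c≥0 e
      ... | inside  | inside  = ≤-refl
      ... | inside  | outside
        with ≡.trans (≡.sym eq′) ([]=⇒lookup (F⊆F′ (lookup⇒[]= e F eq)))
      ...   | ()

    argmin : ∀ {p k} {P : Pred (Subset k) p} → Decidable P →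
             (f : Subset k → Carrier) →
             (∀ S → ¬ P S) ⊎
             (∃ λ S → P S × (∀ S′ → P S′ → f S ≤ f S′))
    argmin {k = ℕ.zero} P? f with P? []
    ... | yes p = inj₂ ([] , p , λ { [] _ → ≤-refl })
    ... | no ¬p = inj₁ λ { [] → ¬p }
    argmin {k = ℕ.suc k} P? f
      with argmin (P? ∘ (inside ∷_)) (f ∘ (inside ∷_))
         | argmin (P? ∘ (outside ∷_)) (f ∘ (outside ∷_))
    ... | inj₁ ¬i | inj₁ ¬o =
      inj₁ λ { (inside ∷ S) → ¬i S ; (outside ∷ S) → ¬o S }
    ... | inj₁ ¬i | inj₂ (S , p , min) = inj₂ (outside ∷ S , p ,
      λ { (inside ∷ S′) p′ → ⊥-elim (¬i S′ p′) ; (outside ∷ S′) → min S′ })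
    ... | inj₂ (S , p , min) | inj₁ ¬o = inj₂ (inside ∷ S , p ,
      λ { (outside ∷ S′) p′ → ⊥-elim (¬o S′ p′) ; (inside ∷ S′) → min S′ })
    ... | inj₂ (S , p , min) | inj₂ (S″ , p″ , min″)
      with total (f (inside ∷ S)) (f (outside ∷ S″))
    ...   | inj₁ le = inj₂ (inside ∷ S , p , λ
      { (inside ∷ S′) → min S′
      ; (outside ∷ S′) p′ → ≤-trans le (min″ S′ p′) })
    ...   | inj₂ ge = inj₂ (outside ∷ S″ , p″ , λ
      { (outside ∷ S′) → min″ S′
      ; (inside ∷ S′) p′ → ≤-trans ge (min S′ p′) })

    -- A cheapest spanning edge set, pruned to a forest.
    minForest : ∀ R → Nonempty R → ∃ (IsMinRootedSpanningForest R)
    minForest R (r , r∈R) with argmin (spans? R) cost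
    ... | inj₁ none            =
      ⊥-elim (none ⊤ λ v → r , r∈R , connected v r)
    ... | inj₂ (F , spans , min) =
      let F′ , F′⊆F , rooted = prune spans
      in F′ , rooted , λ F″ (_ , comp) →
           ≤-trans (cost-mono F′⊆F)
             (min F″ λ v → let r , p , _ = comp v in r , p)

    minCost : ∀ R → Nonempty R → Carrier
    minCost R R≢∅ = cost (proj₁ (minForest R R≢∅))

------------------------------------------------------------------------
-- Random subsets

∪-nonemptyˡ : ∀ {n} {T : Subset n} → Nonempty T → ∀ S → Nonempty (T ∪ S)
∪-nonemptyˡ (t , t∈T) S = t , p⊆p∪q S t∈T

module RandomSubsets {a ℓ₁ ℓ₂} (K : OrderedField a ℓ₁ ℓ₂) where
  open OrderedField K

  sumSubsets : ∀ {n} → (Subset n → Carrier) → Carrier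
  sumSubsets {ℕ.zero}  f = f []
  sumSubsets {ℕ.suc n} f =
    sumSubsets (f ∘ (inside ∷_)) + sumSubsets (f ∘ (outside ∷_))

  record Distribution (n : ℕ) : Set (a ⊔ ℓ₁ ⊔ ℓ₂) where
    field
      weight     : Subset n → Carrier
      isRational : ∀ S → IsNonNegRational (weight S)
      weight≥0   : ∀ S → 0# ≤ weight S
      total≈1    : sumSubsets weight ≈ 1#
  open Distribution public

  SupportedOn : ∀ {n p} → Distribution n → Pred (Subset n) p → Set (p ⊔ ℓ₁)
  SupportedOn μ P = ∀ S → ¬ P S → weight μ S ≈ 0#

  Pr : ∀ {n p} {P : Pred (Subset n) p} → Distribution n → Decidable P → Carrier
  Pr μ P? = sumSubsets λ S → if does (P? S) then weight μ S else 0#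

  E : ∀ {n} → Distribution n → (Subset n → Carrier) → Carrier
  E μ X = sumSubsets λ S → weight μ S * X S

{-# OPTIONS --safe #-}
-- Root every tree of a cheapest T-rooted spanning forest F at its vertex in T,
-- and let each v ∉ T pay for the edge from v to its parent. No edge is paid for
-- twice, so the charges add up to at most c_T. For a random S, the parent edges
-- of the vertices outside T ∪ S form a (T ∪ S)-rooted spanning forest, and
-- v ∉ T pays for its edge with probability Pr[v ∉ S] ≤ γ.
module Submission where

open import Data.Bool.Base using (true; false; if_then_else_)
open import Data.Empty using (⊥-elim)
open import Data.Fin.Base using (Fin; punchIn)
open import Data.Fin.Properties using (any?; punchInᵢ≢i)
open import Data.Fin.Subset using (Subset; Nonempty; _∈_; _∉_; _⊆_; _∪_; ∁; inside; outside)
open import Data.Fin.Subset.Properties using (_∈?_; x∈p∪q⁺; x∈p∪q⁻)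
open import Data.Maybe.Base using (just; nothing; maybe′)
open import Data.Nat.Base as ℕ using (ℕ)
import Data.Nat.Properties as ℕ
open import Data.Product using (_×_; _,_; proj₁; proj₂)
open import Data.Sum using (_⊎_; inj₁; inj₂; [_,_]′)
open import Data.Vec.Base using ([]; _∷_; lookup)
open import Data.Vec.Properties using (lookup∘tabulate)
open import Function.Base using (_∘_)
open import Relation.Binary.Bundles using (Poset)
open import Relation.Binary.PropositionalEquality as ≡ using (_≡_; _≢_)
import Relation.Binary.Reasoning.PartialOrder as PartialOrderReasoning
import Relation.Binary.Reasoning.Setoid as SetoidReasoning
open import Relation.Binary.Structures using (IsTotalOrder)
open import Relation.Nullary using (¬_; yes; no; does; ¬?)
open import Defs

-- Inequalities and finite sums in an ordered field.

module OrderedFieldProperties {a ℓ₁ ℓ₂} (K : OrderedField a ℓ₁ ℓ₂) where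
  open OrderedField K
  open import Algebra.Properties.AbelianGroup +-abelianGroup using (\\-leftDividesˡ)
  open import Algebra.Properties.CommutativeMonoid.Sum +-commutativeMonoid
    using (sum-remove; sum-cong-≋; sum-replicate-zero; ∑-distrib-+)
  open RandomSubsets K using (sumSubsets)

  poset : Poset a ℓ₁ ℓ₂
  poset = record { isPartialOrder = IsTotalOrder.isPartialOrder isTotalOrder }

  -- The order axioms speak only of products of nonnegative elements, so the inequality is used as
  -- nonnegativity of `- x + y`.
  *-monoˡ-≤ : ∀ {z} → 0# ≤ z → ∀ {x y} → x ≤ y → z * x ≤ z * y
  *-monoˡ-≤ {z} z≥0 {x} {y} x≤y = begin
    z * x                      ≈⟨ +-identityʳ _ ⟨
    z * x + 0#                 ≤⟨ +-monoˡ-≤ (z * x) (*-nonNeg z≥0 0≤y-x) ⟩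
    z * x + z * (- x + y)      ≈⟨ distribˡ z x (- x + y) ⟨
    z * (x + (- x + y))        ≈⟨ *-congˡ (\\-leftDividesˡ x y) ⟩
    z * y                      ∎
    where
    open PartialOrderReasoning poset
    0≤y-x : 0# ≤ - x + y
    0≤y-x = ≤-respˡ-≈ (-‿inverseˡ x) (+-monoˡ-≤ (- x) x≤y)

  *-monoʳ-≤ : ∀ {z} → 0# ≤ z → ∀ {x y} → x ≤ y → x * z ≤ y * z
  *-monoʳ-≤ z≥0 x≤y =
    ≤-respˡ-≈ (*-comm _ _) (≤-respʳ-≈ (*-comm _ _) (*-monoˡ-≤ z≥0 x≤y))

  +-mono-≤ : ∀ {w x y z} → w ≤ x → y ≤ z → w + y ≤ x + z
  +-mono-≤ {w} {x} {y} {z} w≤x y≤z = begin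
    w + y  ≤⟨ +-monoˡ-≤ w y≤z ⟩
    w + z  ≈⟨ +-comm w z ⟩
    z + w  ≤⟨ +-monoˡ-≤ z w≤x ⟩
    z + x  ≈⟨ +-comm z x ⟩
    x + z  ∎
    where open PartialOrderReasoning poset

  sum-zero : ∀ {k} (f : Fin k → Carrier) → (∀ i → f i ≈ 0#) → sum f ≈ 0#
  sum-zero {k} f f≈0 = trans (sum-cong-≋ f≈0) (sum-replicate-zero k)

  sum-single : ∀ {k} (f : Fin k → Carrier) i → (∀ j → j ≢ i → f j ≈ 0#) →
               sum f ≈ f i
  sum-single {ℕ.suc k} f i f≈0 = begin
    sum f                          ≈⟨ sum-remove f ⟩
    f i + sum (f ∘ punchIn i)      ≈⟨ +-congˡ (sum-zero _ λ j → f≈0 _ (punchInᵢ≢i i j)) ⟩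
    f i + 0#                       ≈⟨ +-identityʳ _ ⟩
    f i                            ∎
    where open SetoidReasoning setoid

  sumSubsets-mono-≤ : ∀ {k} (f g : Subset k → Carrier) → (∀ S → f S ≤ g S) →
                      sumSubsets f ≤ sumSubsets g
  sumSubsets-mono-≤ {ℕ.zero}  f g f≤g = f≤g []
  sumSubsets-mono-≤ {ℕ.suc k} f g f≤g =
    +-mono-≤ (sumSubsets-mono-≤ _ _ (f≤g ∘ (inside ∷_)))
             (sumSubsets-mono-≤ _ _ (f≤g ∘ (outside ∷_)))

  sumSubsets-cong : ∀ {k} (f g : Subset k → Carrier) → (∀ S → f S ≈ g S) →
                    sumSubsets f ≈ sumSubsets g
  sumSubsets-cong {ℕ.zero}  f g f≈g = f≈g []
  sumSubsets-cong {ℕ.suc k} f g f≈g =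
    +-cong (sumSubsets-cong _ _ (f≈g ∘ (inside ∷_)))
           (sumSubsets-cong _ _ (f≈g ∘ (outside ∷_)))

  *-distribʳ-sumSubsets : ∀ {k} x (f : Subset k → Carrier) →
                          sumSubsets f * x ≈ sumSubsets (λ S → f S * x)
  *-distribʳ-sumSubsets {ℕ.zero}  x f = refl
  *-distribʳ-sumSubsets {ℕ.suc k} x f = trans (distribʳ x _ _)
    (+-cong (*-distribʳ-sumSubsets x (f ∘ (inside ∷_)))
            (*-distribʳ-sumSubsets x (f ∘ (outside ∷_))))

  -- This is what linearity of expectation rests on: an expected total charge can be computed vertex
  -- by vertex.
  sumSubsets-∑-comm : ∀ {k l} (f : Subset k → Fin l → Carrier) →
                      sumSubsets (λ S → sum (f S)) ≈
                      ∑[ i < l ] sumSubsets (λ S → f S i)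
  sumSubsets-∑-comm {ℕ.zero}  f = refl
  sumSubsets-∑-comm {ℕ.suc k} f = trans
    (+-cong (sumSubsets-∑-comm (f ∘ (inside ∷_)))
            (sumSubsets-∑-comm (f ∘ (outside ∷_))))
    (sym (∑-distrib-+ (λ i → sumSubsets λ S → f (inside ∷ S) i) _))

-- Distributing the cost of a forest over its vertices.

module ParentCharges
  {a ℓ₁ ℓ₂} (K : OrderedField a ℓ₁ ℓ₂)
  (G : Graph) (connected : Graph.IsConnected G)
  (c : Graph.Edge G → OrderedField.Carrier K)
  (c≥0 : ∀ e → OrderedField._≤_ K (OrderedField.0# K) (c e))
  where
  open OrderedField K
  open OrderedFieldProperties K
  open RandomSubsets K
  open Graph G
  open ParentPointers G
  open ForestCosts K G connected c c≥0 hiding (+-mono-≤)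
  open import Algebra.Properties.Semiring.Sum semiring
    using (sum-cong-≋; ∑-comm; *-distribˡ-sum)

  charge : ∀ {R F} → Parents R F → Vertex → Carrier
  charge P v = maybe′ c 0# (Tree.parentEdge P v)

  -- A root has no parent edge and is charged `0#`, so the two coefficients need comparing only at
  -- vertices outside `R`.
  *-charge-mono-≤ : ∀ {R F} (P : Parents R F) {x y} v → (v ∉ R → x ≤ y) →
                    x * charge P v ≤ y * charge P v
  *-charge-mono-≤ P v x≤y with Parents.up P v
  ... | inj₁ _         = ≤-reflexive (trans (zeroʳ _) (sym (zeroʳ _)))
  ... | inj₂ (v∉R , s) = *-monoʳ-≤ (c≥0 (Step.edge s)) (x≤y v∉R)

  module _ {R F} (P : Parents R F) where
    open Parents P
    open Tree P

    -- If e were the parent edge of both of its endpoints, each of them would be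
    -- deeper than the other.
    parentEdge-injective : ∀ {u v e} → ParentEdge u e → ParentEdge v e → u ≡ v
    parentEdge-injective {u} {v} p q with up u | up v
    parentEdge-injective ≡.refl q | inj₂ (_ , s) | inj₂ (_ , t) =
      lemma s t q
      where
      lemma : ∀ {u v} (s : Step F depth u) (t : Step F depth v) →
              just (Step.edge t) ≡ just (Step.edge s) → u ≡ v
      lemma (step e p _ j d) (step .e p′ _ j′ d′) ≡.refl with joins-det j j′
      ... | inj₁ (u≡v , _)            = u≡v
      ... | inj₂ (≡.refl , ≡.refl) = ⊥-elim (ℕ.<-asym d d′)

    -- A vertex-by-edge matrix for double counting: its row sums are the charges, its column sums
    -- the costs of the single forest edges.
    charge-at : Vertex → Edge → Carrier
    charge-at v e = if does (parentEdge? v e) then c e else 0#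

    charge-at-miss : ∀ {v e} → ¬ ParentEdge v e → charge-at v e ≈ 0#
    charge-at-miss {v} {e} ¬p with parentEdge? v e
    ... | yes p = ⊥-elim (¬p p)
    ... | no  _ = refl

    charge-at-hit : ∀ {v e} → ParentEdge v e → charge-at v e ≈ c e
    charge-at-hit {v} {e} p with parentEdge? v e
    ... | yes _ = refl
    ... | no ¬p = ⊥-elim (¬p p)

    -- Row `v` has at most one nonzero entry, at the parent edge of `v`.
    ∑-charge-at-vertex : ∀ v → ∑[ e < m ] charge-at v e ≈ charge P v
    -- Only the right-hand side is generalised over `parentEdge v`; the entries `charge-at v e` stay
    -- folded, so the hit and miss lemmas apply to them.
    ∑-charge-at-vertex v = cases (parentEdge v) ≡.refl
      where
      cases : ∀ x → parentEdge v ≡ x →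
              ∑[ e < m ] charge-at v e ≈ maybe′ c 0# x
      cases nothing  eq = sum-zero (charge-at v) λ e → charge-at-miss λ p →
        nothing≢just (≡.trans (≡.sym eq) p)
        where
        nothing≢just : ∀ {e : Edge} → nothing ≢ just e
        nothing≢just ()
      cases (just f) eq = trans
        (sum-single (charge-at v) f λ e e≢f → charge-at-miss λ p → e≢f (unique p eq))
        (charge-at-hit eq)

    -- Column `e` has at most one nonzero entry, because only one vertex can have `e` as its parent
    -- edge.
    ∑-charge-at-edge : ∀ e → ∑[ v < n ] charge-at v e ≈
                             (if lookup forest e then c e else 0#)
    ∑-charge-at-edge e
      -- Membership in `forest` unfolds to the search for a child of `e`, which also decides whether
      -- the column vanishes.
      rewrite lookup∘tabulate (λ e → does (any? λ v → parentEdge? v e)) e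
      with any? (λ v → parentEdge? v e)
    ... | no ¬p       = sum-zero _ λ v → charge-at-miss λ p → ¬p (v , p)
    ... | yes (u , p) = trans
      (sum-single _ u λ v v≢u → charge-at-miss λ q →
        v≢u (parentEdge-injective q p))
      (charge-at-hit p)

    -- Summing the matrix in both orders. Both directions matter: the charges bound the cost for
    -- `T ∪ S` from above, and for `T` they add up to no more than the cost of the tree edges.
    cost-forest : cost forest ≈ sum (charge P)
    cost-forest = begin
      cost forest                              ≈⟨ sum-cong-≋ ∑-charge-at-edge ⟨
      ∑[ e < m ] ∑[ v < n ] charge-at v e      ≈⟨ ∑-comm (λ e v → charge-at v e) ⟩
      ∑[ v < n ] ∑[ e < m ] charge-at v e      ≈⟨ sum-cong-≋ ∑-charge-at-vertex ⟩
      sum (charge P)                           ∎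
      where open SetoidReasoning setoid

  minCost-≤ : ∀ {R F} (R≢∅ : Nonempty R) → IsRootedSpanningForest R F →
              minCost R R≢∅ ≤ cost F
  minCost-≤ {R} R≢∅ rooted = proj₂ (proj₂ (minForest R R≢∅)) _ rooted

  -- Turning the vertices of a set into further roots.

  module _ {R F} (P : Parents R F) (S : Subset n) where
    open Parents P

    -- A vertex of `S` gives up its parent edge and every other vertex keeps its step, so the old
    -- depths still decrease along each step.
    addRoots : Parents (R ∪ S) F
    addRoots = record { depth = depth ; up = up′ }
      where
      up′ : ∀ v → v ∈ R ∪ S ⊎ (v ∉ R ∪ S × Step F depth v)
      up′ v with v ∈? S | up v
      ... | yes v∈S | _              = inj₁ (x∈p∪q⁺ (inj₂ v∈S))
      ... | no  _   | inj₁ v∈R       = inj₁ (x∈p∪q⁺ (inj₁ v∈R))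
      ... | no  v∉S | inj₂ (v∉R , s) =
        inj₂ ([ v∉R , v∉S ]′ ∘ x∈p∪q⁻ R S , s)

    -- The indicator has the same form as in `Pr`, so that weighting it and summing over `S` yields
    -- the probability that `v` is missed.
    charge-addRoots : ∀ v → charge addRoots v ≡
                            (if does (¬? (v ∈? S)) then charge P v else 0#)
    charge-addRoots v with v ∈? S | up v
    ... | yes _ | _      = ≡.refl
    ... | no  _ | inj₁ _ = ≡.refl
    ... | no  _ | inj₂ _ = ≡.refl

  -- Moves the indicator of `v ∉ S` from the charge to the weight of `S`.
  if-*-comm : ∀ b x y → x * (if b then y else 0#) ≈ (if b then x else 0#) * y
  if-*-comm true  x y = refl
  if-*-comm false x y = trans (zeroʳ x) (sym (zeroˡ y))

  -- Expected cost with random extra roots.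

  module _ {T : Subset n} (T≢∅ : Nonempty T) (μ : Distribution n) where

    -- For each `S` the minimum is at most the cost of one candidate, the forest of `addRoots P S`;
    -- its expected total charge is then regrouped by vertex.
    E-minCost≤ : ∀ {F} (P : Parents T F) →
      E μ (λ S → minCost (T ∪ S) (∪-nonemptyˡ T≢∅ S)) ≤
      ∑[ v < n ] (Pr μ (λ S → ¬? (v ∈? S)) * charge P v)
    E-minCost≤ P = begin
      E μ (λ S → minCost (T ∪ S) (∪-nonemptyˡ T≢∅ S))
        ≤⟨ sumSubsets-mono-≤ _ _ (λ S → *-monoˡ-≤ (weight≥0 μ S) (minCost≤ S)) ⟩
      E μ (λ S → sum (charge (addRoots P S)))
        ≈⟨ sumSubsets-cong _ _ distribute ⟩
      sumSubsets (λ S → ∑[ v < n ] (weight∉ v S * charge P v))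
        ≈⟨ sumSubsets-∑-comm (λ S v → weight∉ v S * charge P v) ⟩
      ∑[ v < n ] sumSubsets (λ S → weight∉ v S * charge P v)
        ≈⟨ sum-cong-≋ (λ v → *-distribʳ-sumSubsets (charge P v) (weight∉ v)) ⟨
      ∑[ v < n ] (Pr μ (λ S → ¬? (v ∈? S)) * charge P v)
        ∎
      where
      open PartialOrderReasoning poset
      weight∉ : Vertex → Subset n → Carrier
      weight∉ v S = if does (¬? (v ∈? S)) then weight μ S else 0#
      minCost≤ : ∀ S → minCost (T ∪ S) (∪-nonemptyˡ T≢∅ S) ≤
                       sum (charge (addRoots P S))
      minCost≤ S = ≤-respʳ-≈ (cost-forest (addRoots P S))
        (minCost-≤ _ (Tree.forest-rooted (addRoots P S)))
      distribute : ∀ S → weight μ S * sum (charge (addRoots P S)) ≈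
                         ∑[ v < n ] (weight∉ v S * charge P v)
      distribute S = trans
        (*-distribˡ-sum (weight μ S) (charge (addRoots P S)))
        (sum-cong-≋ λ v → trans
          (*-congˡ (reflexive (charge-addRoots P S v)))
          (if-*-comm (does (¬? (v ∈? S))) _ _))

theorem3 :
  ∀ {a ℓ₁ ℓ₂} (K : OrderedField a ℓ₁ ℓ₂) →
  let open OrderedField K
      open RandomSubsets K in
  (G : Graph) →
  let open Graph G in
  (connected : IsConnected)
  (c : Edge → Carrier) (c≥0 : ∀ e → 0# ≤ c e) →
  let open ForestCosts K G connected c c≥0 in
  (T : Subset n) (T≢∅ : Nonempty T)
  (μ : Distribution n) → SupportedOn μ (_⊆ ∁ T) →
  (γ : Carrier) → 0# ≤ γ →
  (∀ v → v ∉ T → Pr μ (λ S → ¬? (v ∈? S)) ≤ γ) →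
  E μ (λ S → minCost (T ∪ S) (∪-nonemptyˡ T≢∅ S)) ≤ γ * minCost T T≢∅
theorem3 K G connected c c≥0 T T≢∅ μ _ γ γ≥0 Pr≤γ = begin
  E μ (λ S → minCost (T ∪ S) (∪-nonemptyˡ T≢∅ S))
    ≤⟨ E-minCost≤ T≢∅ μ P ⟩
  ∑[ v < n ] (Pr μ (λ S → ¬? (v ∈? S)) * charge P v)
    ≤⟨ sum-mono-≤ _ _ (λ v → *-charge-mono-≤ P v (Pr≤γ v)) ⟩
  ∑[ v < n ] (γ * charge P v)
    ≈⟨ *-distribˡ-sum γ (charge P) ⟨
  γ * sum (charge P)
    ≈⟨ *-congˡ (cost-forest P) ⟨
  γ * cost (Tree.forest P)
    -- The parent edges all come from the cheapest forest `F`, and edge costs are nonnegative.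
    ≤⟨ *-monoˡ-≤ γ≥0 (cost-mono (Tree.forest⊆F P)) ⟩
  γ * minCost T T≢∅
    ∎
  where
  open OrderedField K
  open OrderedFieldProperties K
  open RandomSubsets K
  open Graph G
  open ParentPointers G
  open ForestCosts K G connected c c≥0 hiding (+-mono-≤)
  open ParentCharges K G connected c c≥0
  open import Algebra.Properties.Semiring.Sum semiring using (*-distribˡ-sum)
  open PartialOrderReasoning poset
  F : Subset m
  F = proj₁ (minForest T T≢∅)
  P : Parents T F
  -- The root of the component of `v` in `F` provides the walk from `v` to `T`.
  P = shortestParents T F λ v →
    let r , p , _ = proj₂ (proj₁ (proj₂ (minForest T T≢∅))) v in r , p
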